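{- Fix an integer $k\geq 2$. Let $G=(V,E)$ be a finite simple graph and suppose $EMH_{n,n}(G)\cong 0$ for all $2\leq n\leq k$. Then $MH_{k,k}(G)\cong\ker(\partial_{k,k})\subseteq MC_{k,k}(G)$ is generated by $k$-trails of the form $(x_0,x_1,x_0,x_1,\dots)$ which visit only one pair of vertices $x_0\neq x_1\in V$.
   Context: Graphs are finite, simple and undirected; $d$ is the path metric. $[m]=\{1,\dots,m\}$, $[m]_0=\{0,\dots,m\}$. A $k$-trail in $G=(V,E)$ is $(x_0,\dots,x_k)\in V^{k+1}$ with $x_i\neq x_{i+1}$ and $d(x_i,x_{i+1})<\infty$ for $i\in[k-1]_0$; its length is $\sum_i d(x_i,x_{i+1})$. $MC_{k,\ell}(G)$ is the free abelian group on $k$-trails of length $\ell$, with differential $\partial_{k,\ell}=\sum_{i=1}^{k-1}(-1)^i\partial^i_{k,\ell}$, where $\partial^i_{k,\ell}(x_0,\dots,x_k)=(x_0,\dots,\widehat{x_i},\dots,x_k)$ if this tuple has length $\ell$ and $0$ otherwise; $MH_{k,\ell}(G)=\ker\partial_{k,\ell}/\mathrm{im}\,\partial_{k+1,\ell}$ (magnitude homology). A $k$-trail is eulerian if its entries are pairwise distinct; the eulerian ones span a subcomplex $EMC_{*,\ell}(G)$, whose homology is the eulerian magnitude homology $EMH_{k,\ell}(G)$. -}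

module Defs where

open import Data.Bool using (Bool; true; false; _∧_; _∨_; not; if_then_else_)
open import Data.Nat using (ℕ; zero; suc; _<ᵇ_)
open import Data.Fin using (Fin; toℕ)
open import Data.Fin.Properties using () renaming (_≟_ to _≟ᶠ_)
open import Data.Bool.ListAction using (any)
open import Data.List using (List; []; _∷_; allFin; foldr; concatMap) renaming (map to mapL)
open import Data.Vec using (Vec; []; _∷_; removeAt)
open import Data.Vec.Properties using (≡-dec)
open import Data.Vec.Relation.Unary.Unique.Propositional using (Unique)
open import Data.Maybe using (Maybe; just; nothing)
open import Data.Integer using (ℤ; 0ℤ; 1ℤ; -1ℤ; _*_) renaming (_+_ to _+ℤ_)
open import Data.Product using (_×_)
open import Relation.Nullary.Decidable using (⌊_⌋)
open import Relation.Binary.PropositionalEquality using (_≡_; _≢_)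

record Graph (N : ℕ) : Set where
  field
    adj     : Fin N → Fin N → Bool
    adj-sym : ∀ x y → adj x y ≡ adj y x
    irrefl  : ∀ x → adj x x ≡ false

open Graph public

module _ {N : ℕ} (G : Graph N) where

  reach : ℕ → Fin N → Fin N → Bool
  reach zero    x y = ⌊ x ≟ᶠ y ⌋
  reach (suc m) x y = reach m x y ∨ any (λ z → adj G x z ∧ reach m z y) (allFin N)

  -- path metric: least m with a walk of length m (a shortest path has < N edges);
  -- nothing encodes d(x,y) = ∞
  dist : Fin N → Fin N → Maybe ℕ
  dist x y = go 0 N
    where
    go : ℕ → ℕ → Maybe ℕ
    go m zero    = if reach m x y then just m else nothing
    go m (suc f) = if reach m x y then just m else go (suc m) f

  -- lenM t = just ℓ  iff  t is a trail (consecutive entries distinct, at finite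
  -- distance) of length ℓ
  lenM : ∀ {n} → Vec (Fin N) n → Maybe ℕ
  lenM []               = nothing
  lenM (x ∷ [])         = just 0
  lenM (x ∷ y ∷ r) with ⌊ x ≟ᶠ y ⌋ | dist x y | lenM (y ∷ r)
  ... | false | just a | just b = just (a Data.Nat.+ b)
  ... | _     | _      | _      = nothing

  allVecs : (n : ℕ) → List (Vec (Fin N) n)
  allVecs zero    = [] ∷ []
  allVecs (suc n) = concatMap (λ x → mapL (x ∷_) (allVecs n)) (allFin N)

  sumℤ : List ℤ → ℤ
  sumℤ = foldr _+ℤ_ 0ℤ

  δ : ∀ {n} → Vec (Fin N) n → Vec (Fin N) n → ℤ
  δ x y = if ⌊ ≡-dec _≟ᶠ_ x y ⌋ then 1ℤ else 0ℤ

  sign : ℕ → ℤ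
  sign zero          = 1ℤ
  sign (suc zero)    = -1ℤ
  sign (suc (suc i)) = sign i

  -- Chains: a (finitely supported, since N is finite) ℤ-valued function on
  -- (k+1)-tuples; the basis element of a tuple t is  δ t.
  Chain : ℕ → Set
  Chain k = Vec (Fin N) (suc k) → ℤ

  InMC : (k ℓ : ℕ) → Chain k → Set
  InMC k ℓ c = ∀ t → c t ≢ 0ℤ → lenM t ≡ just ℓ

  InEMC : (k ℓ : ℕ) → Chain k → Set
  InEMC k ℓ c = ∀ t → c t ≢ 0ℤ → (lenM t ≡ just ℓ) × Unique t

  faceCoeff : ∀ {k} (ℓ : ℕ) → Vec (Fin N) (suc k) → Fin (suc k) → Vec (Fin N) k → ℤ
  faceCoeff ℓ t i s with lenM (removeAt t i)
  ... | just l = if ⌊ l Data.Nat.≟ ℓ ⌋ then δ (removeAt t i) s else 0ℤ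
  ... | nothing = 0ℤ

  ∂ : (k ℓ : ℕ) → Chain k → Vec (Fin N) k → ℤ
  ∂ k ℓ c s = sumℤ (mapL (λ t → sumℤ (mapL (λ i →
                if (0 <ᵇ toℕ i) ∧ (toℕ i <ᵇ k)
                then c t * (sign (toℕ i) * faceCoeff ℓ t i s)
                else 0ℤ) (allFin (suc k)))) (allVecs (suc k)))

  EMHnnVanishes : ℕ → Set
  EMHnnVanishes n =
    ∀ (c : Chain n) → InEMC n n c → (∀ s → ∂ n n c s ≡ 0ℤ) →
    Data.Product.Σ (Chain (suc n)) λ b →
      InEMC (suc n) n b × (∀ t → ∂ (suc n) n b t ≡ c t)

  alt : Fin N → Fin N → (n : ℕ) → Vec (Fin N) n
  alt u v zero    = []
  alt u v (suc n) = u ∷ alt v u n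

  InAltSpan : (k : ℕ) → Chain k → Set
  InAltSpan k c =
    Data.Product.Σ (Fin N → Fin N → ℤ) λ a →
      (∀ u v → a u v ≢ 0ℤ → (u ≢ v) × (lenM (alt u v (suc k)) ≡ just k)) ×
      (∀ t → c t ≡ sumℤ (mapL (λ u → sumℤ (mapL (λ v →
                 a u v * δ (alt u v (suc k)) t) (allFin N))) (allFin N)))

  Vec' : ℕ → Set
  Vec' n = Vec (Fin N) (suc n)

{-# OPTIONS --safe #-}
-- There are no 3-trails of length 2, so EMH_{2,2}(G) = 0 means that no nonzero eulerian
-- 2-chain of length 2 is a cycle.  A triangle a,m,b would make (a,m,b)
-- a cycle, and two common neighbours m ≠ m′ of a ≠ b would make (a,m,b) − (a,m′,b) one;
-- hence G has no triangle and no 4-cycle.  A k-trail of length k is a walk, and a nonzero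
-- face of it has exactly one step of length 2, which locates the deleted vertex; the
-- absence of 4-cycles determines that vertex.  So a walk with a nonzero face is the only
-- one having that face, and its coefficient in a cycle is zero.  In a triangle-free graph
-- the walks without nonzero faces are the alternating ones.
module Submission where

open import Defs
open import Data.Bool using (Bool; true; false; T; _∧_; if_then_else_)
open import Data.Bool.Properties using (T-∧; T-∨; T-≡)
open import Data.Fin using (Fin; zero; suc; toℕ)
open import Data.Fin.Properties using () renaming (_≟_ to _≟ᶠ_)
open import Data.Integer using (ℤ; 0ℤ; 1ℤ; -1ℤ; _-_) renaming (_+_ to _+ℤ_; _*_ to _*ℤ_)
import Data.Integer.Properties as ℤ
open import Data.Integer.Tactic.RingSolver using (solve-∀)
open import Data.List using (List; []; _∷_; _++_; allFin; concatMap) renaming (map to mapL)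
open import Data.List.Membership.Propositional using (_∈_; lose; find)
open import Data.List.Membership.Propositional.Properties using (∈-allFin)
open import Data.List.Properties using () renaming (map-++ to mapL-++; map-∘ to mapL-∘; map-cong to mapL-cong)
import Data.List.Relation.Unary.All as All
open import Data.List.Relation.Unary.Any using (here; there)
open import Data.List.Relation.Unary.Any.Properties using (any⁺; any⁻)
open import Data.List.Relation.Unary.AllPairs using (_∷_)
import Data.List.Relation.Unary.Unique.Propositional as List
open import Data.List.Relation.Unary.Unique.Propositional.Properties using (allFin⁺)
open import Data.Maybe using (Maybe; just; nothing)
open import Data.Maybe.Properties using (just-injective)
open import Data.Nat using (ℕ; zero; suc; _+_; _≤_; z≤n; s≤s; _<ᵇ_; _≟_)
open import Data.Nat.Properties using (≤-refl; ≤-trans; m≤n+m; 1+n≰n; 1+n≢n; +-mono-≤)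
open import Data.Product using (_×_; _,_; proj₁; proj₂; ∃; ∃₂)
open import Data.Sum using (_⊎_; inj₁; inj₂; [_,_]′)
open import Data.Vec using (Vec; []; _∷_; removeAt)
open import Data.Vec.Properties using (≡-dec; ∷-injective; ∷-injectiveˡ; ∷-injectiveʳ)
open import Data.Vec.Relation.Unary.All using ([]; _∷_)
open import Data.Vec.Relation.Unary.AllPairs using ([]; _∷_)
open import Data.Vec.Relation.Unary.Linked using (Linked; [-]; _∷_)
open import Data.Vec.Relation.Unary.Unique.Propositional using (Unique)
open import Function using (_∘_; module Equivalence)
open import Relation.Binary.PropositionalEquality using (_≡_; _≢_; refl; sym; trans; cong; cong₂; subst; ≢-sym; module ≡-Reasoning)
open import Relation.Nullary using (¬_; yes; no; contradiction)
open import Relation.Nullary.Decidable using (toWitness; fromWitness; decidable-stable)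

open Equivalence using (to; from)

-- `search` names the local function `go` of `dist`, which is not in scope: Agda infers it
-- from `dist-suc`.  Abstracting `suc f` and `1` there separates the number of vertices,
-- the current radius and the fuel, so that the inference problem has a unique solution.
mutual
  search : ∀ {N} (G : Graph N) (x y : Fin N) → ℕ → ℕ → Maybe ℕ
  search = _

  dist-suc : ∀ {f} (G : Graph (suc f)) x y →
             dist G x y ≡ (if reach G 0 x y then just 0 else search G x y 1 f)
  dist-suc {f} G x y with suc f | 1
  ... | _ | _ = refl

module _ {N : ℕ} (G : Graph N) where

  -- Adjacency and walks

  Adj : Fin N → Fin N → Set
  Adj x y = T (adj G x y)

  Adj⇒≢ : ∀ {x y} → Adj x y → x ≢ y
  Adj⇒≢ {x} x~x refl = subst T (irrefl G x) x~x

  Walk : ∀ {n} → Vec (Fin N) n → Set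
  Walk = Linked Adj

  -- The path metric

  reach-suc⁺ : ∀ {m x z y} → Adj x z → T (reach G m z y) → T (reach G (suc m) x y)
  reach-suc⁺ {z = z} x~z r =
    from T-∨ (inj₂ (any⁺ _ (lose (∈-allFin z) (from T-∧ (x~z , r)))))

  reach-suc⁻ : ∀ {m x y} → T (reach G (suc m) x y) →
               T (reach G m x y) ⊎ ∃ λ z → Adj x z × T (reach G m z y)
  reach-suc⁻ r with to T-∨ r
  ... | inj₁ r′ = inj₁ r′
  ... | inj₂ s  with find (any⁻ _ (allFin N) s)
  ...   | z , _ , q = inj₂ (z , to T-∧ q)

  reach₁⇒Adj : ∀ {x y} → x ≢ y → T (reach G 1 x y) → Adj x y
  reach₁⇒Adj x≢y r with reach-suc⁻ {0} r
  ... | inj₁ x≡y = contradiction (toWitness x≡y) x≢y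
  ... | inj₂ (z , x~z , z≡y) = subst (Adj _) (toWitness z≡y) x~z

  Adj⇒reach₁ : ∀ {x y} → Adj x y → T (reach G 1 x y)
  Adj⇒reach₁ {y = y} x~y = reach-suc⁺ {0} x~y (fromWitness {a? = y ≟ᶠ y} refl)

  search-hit : ∀ {x y m} f → T (reach G m x y) → search G x y m f ≡ just m
  search-hit {x} {y} {m} zero    r with reach G m x y
  ... | true = refl
  search-hit {x} {y} {m} (suc f) r with reach G m x y
  ... | true = refl

  search-miss : ∀ {x y m} f → ¬ T (reach G m x y) →
                search G x y m (suc f) ≡ search G x y (suc m) f
  search-miss {x} {y} {m} f ¬r with reach G m x y
  ... | true  = contradiction _ ¬r
  ... | false = refl

  search-sound : ∀ {x y m a} f → search G x y m f ≡ just a → T (reach G a x y)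
  search-sound {x} {y} {m} zero    eq with reach G m x y in r
  search-sound zero    refl | true = from T-≡ r
  search-sound {x} {y} {m} (suc f) eq with reach G m x y in r
  search-sound (suc f) refl | true  = from T-≡ r
  search-sound (suc f) eq   | false = search-sound f eq

  dist≢0 : ∀ {x y a} → x ≢ y → dist G x y ≡ just a → 1 ≤ a
  dist≢0 {a = zero}  x≢y eq = contradiction (toWitness (search-sound N eq)) x≢y
  dist≢0 {a = suc a} x≢y eq = s≤s z≤n

  dist≡1⇒Adj : ∀ {x y} → x ≢ y → dist G x y ≡ just 1 → Adj x y
  dist≡1⇒Adj x≢y eq = reach₁⇒Adj x≢y (search-sound N eq)

-- Radius 0 is missed because adjacent vertices differ, and radius 1 is hit. The miss spends one
-- unit of fuel, which matching on `suc f` exposes.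
Adj⇒dist≡1 : ∀ {N} (G : Graph N) {x y} → Adj G x y → dist G x y ≡ just 1
Adj⇒dist≡1 {suc f} G x~y =
  trans (search-miss G f (Adj⇒≢ G x~y ∘ toWitness)) (search-hit G f (Adj⇒reach₁ G x~y))

common-neighbour⇒dist≡2 : ∀ {N} (G : Graph N) {x z y} → x ≢ y → ¬ Adj G x y →
                          Adj G x z → Adj G z y → dist G x y ≡ just 2
-- Reaching radius 2 spends two units of fuel, so the graph on one vertex is split off.
common-neighbour⇒dist≡2 {suc zero} G {zero} {y = zero} x≢y = contradiction refl x≢y
common-neighbour⇒dist≡2 {suc (suc f)} G {x} {z} {y} x≢y x≁y x~z z~y = begin
  search G x y 0 (suc (suc f))  ≡⟨ search-miss G {x} {y} {0} (suc f) (x≢y ∘ toWitness) ⟩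
  search G x y 1 (suc f)        ≡⟨ search-miss G {x} {y} {1} f (x≁y ∘ reach₁⇒Adj G x≢y) ⟩
  search G x y 2 f              ≡⟨ search-hit G {x} {y} {2} f (reach-suc⁺ G {1} {x} {z} {y} x~z (Adj⇒reach₁ G z~y)) ⟩
  just 2                        ∎
  where open ≡-Reasoning

module _ {N : ℕ} (G : Graph N) where

  -- Lengths of trails

  lenM-∷⁻ : ∀ {n ℓ} x y (r : Vec (Fin N) n) → lenM G (x ∷ y ∷ r) ≡ just ℓ →
            x ≢ y × ∃₂ λ a b → dist G x y ≡ just a × lenM G (y ∷ r) ≡ just b × a + b ≡ ℓ
  lenM-∷⁻ x y r eq with x ≟ᶠ y | dist G x y | lenM G (y ∷ r)
  lenM-∷⁻ x y r refl | no x≢y | just a | just b = x≢y , a , b , refl , refl , refl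

  lenM-∷⁺ : ∀ {n a b} x y (r : Vec (Fin N) n) → x ≢ y → dist G x y ≡ just a →
            lenM G (y ∷ r) ≡ just b → lenM G (x ∷ y ∷ r) ≡ just (a + b)
  lenM-∷⁺ x y r x≢y eq₁ eq₂ with x ≟ᶠ y | dist G x y | lenM G (y ∷ r)
  ... | yes x≡y | _ | _ = contradiction x≡y x≢y
  lenM-∷⁺ x y r x≢y refl refl | no _ | just a | just b = refl

  lenM-Adj-∷ : ∀ {n b x y} (r : Vec (Fin N) n) → Adj G x y →
               lenM G (y ∷ r) ≡ just b → lenM G (x ∷ y ∷ r) ≡ just (suc b)
  lenM-Adj-∷ {x = x} {y} r x~y = lenM-∷⁺ x y r (Adj⇒≢ G x~y) (Adj⇒dist≡1 G x~y)

  -- Distinct vertices are at distance at least 1. This makes `MC` and `EMC` vanish in degree k+1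
  -- and length k.
  steps≤length : ∀ {k ℓ} (t : Vec (Fin N) (suc k)) → lenM G t ≡ just ℓ → k ≤ ℓ
  steps≤length (x ∷ [])    eq = z≤n
  steps≤length (x ∷ y ∷ r) eq with lenM-∷⁻ x y r eq
  ... | x≢y , a , b , da , lb , refl = +-mono-≤ (dist≢0 G x≢y da) (steps≤length (y ∷ r) lb)

  walk-length : ∀ {k} {t : Vec (Fin N) (suc k)} → Walk G t → lenM G t ≡ just k
  walk-length [-]                      = refl
  walk-length (_∷_ {xs = y ∷ r} x~y w) = lenM-Adj-∷ r x~y (walk-length w)

  length⇒walk : ∀ {k} (t : Vec (Fin N) (suc k)) → lenM G t ≡ just k → Walk G t
  length⇒walk (x ∷ [])    eq = [-]
  length⇒walk (x ∷ y ∷ r) eq with lenM-∷⁻ x y r eq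
  ... | x≢y , zero , b , da , lb , _ = contradiction (dist≢0 G x≢y da) 1+n≰n
  ... | x≢y , suc zero , b , da , lb , refl = dist≡1⇒Adj G x≢y da ∷ length⇒walk (y ∷ r) lb
  -- A first step of length at least 2 leaves the tail a length below its number of steps.
  ... | x≢y , suc (suc a) , b , da , lb , refl =
    contradiction (steps≤length (y ∷ r) lb) (m+1+n≰n a b)
    where
    m+1+n≰n : ∀ m n → ¬ suc (m + n) ≤ n
    m+1+n≰n m n le = 1+n≰n (≤-trans (s≤s (m≤n+m n m)) le)

  trail-steps-distinct : ∀ {n ℓ} (t : Vec (Fin N) (suc n)) → lenM G t ≡ just ℓ → Linked _≢_ t
  trail-steps-distinct (x ∷ [])    eq = [-]
  trail-steps-distinct (x ∷ y ∷ r) eq with lenM-∷⁻ x y r eq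
  ... | x≢y , _ , _ , _ , lb , _ = x≢y ∷ trail-steps-distinct (y ∷ r) lb

-- The indices 1, …, k−1 of the vertices deleted by the faces of a k-trail.
data Interior : ∀ {k} → Fin (suc k) → Set where
  first : ∀ {k} → Interior {suc (suc k)} (suc zero)
  later : ∀ {k} {i : Fin k} → Interior (suc i) → Interior (suc (suc i))

-- This is the guard in `∂`; `Interior` is its inductive form, suited to recursion along a tuple.
isInterior : ∀ {k} → Fin (suc k) → Bool
isInterior {k} i = (0 <ᵇ toℕ i) ∧ (toℕ i <ᵇ k)

Interior⁺ : ∀ {k} {i : Fin (suc k)} → isInterior i ≡ true → Interior i
Interior⁺ {suc zero}    {suc zero}    ()
Interior⁺ {suc (suc k)} {suc zero}    eq = first
Interior⁺ {suc (suc k)} {suc (suc i)} eq = later (Interior⁺ eq)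

Interior⁻ : ∀ {k} {i : Fin (suc k)} → Interior i → isInterior i ≡ true
Interior⁻ first     = refl
Interior⁻ {suc (suc k)} (later p) = Interior⁻ p

module _ {N : ℕ} (G : Graph N) where

  -- Finite sums

  sum-zero : ∀ {A : Set} (f : A → ℤ) xs → (∀ {x} → x ∈ xs → f x ≡ 0ℤ) →
             sumℤ G (mapL f xs) ≡ 0ℤ
  sum-zero f []       f≡0 = refl
  sum-zero f (x ∷ xs) f≡0 = cong₂ _+ℤ_ (f≡0 (here refl)) (sum-zero f xs (f≡0 ∘ there))

  sum-single : ∀ {A : Set} (f : A → ℤ) {xs x} → List.Unique xs → x ∈ xs →
               (∀ y → y ≢ x → f y ≡ 0ℤ) → sumℤ G (mapL f xs) ≡ f x
  sum-single f {x ∷ xs} (x∉xs ∷ _) (here refl) f≡0 =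
    trans (cong (f x +ℤ_) (sum-zero f xs λ y∈xs → f≡0 _ (≢-sym (All.lookup x∉xs y∈xs))))
          (ℤ.+-identityʳ (f x))
  sum-single f {y ∷ xs} (y∉xs ∷ u) (there x∈xs) f≡0 =
    trans (cong₂ _+ℤ_ (f≡0 y (All.lookup y∉xs x∈xs)) (sum-single f u x∈xs f≡0))
          (ℤ.+-identityˡ _)

  sum-allFin-single : ∀ {n} (f : Fin n → ℤ) i → (∀ j → j ≢ i → f j ≡ 0ℤ) →
                      sumℤ G (mapL f (allFin n)) ≡ f i
  sum-allFin-single {n} f i = sum-single f (allFin⁺ n) (∈-allFin i)

  sum-++ : ∀ xs ys → sumℤ G (xs ++ ys) ≡ sumℤ G xs +ℤ sumℤ G ys
  sum-++ []       ys = sym (ℤ.+-identityˡ _)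
  sum-++ (x ∷ xs) ys = trans (cong (x +ℤ_) (sum-++ xs ys)) (sym (ℤ.+-assoc x _ _))

  sum-concatMap : ∀ {A B : Set} (f : B → ℤ) (g : A → List B) xs →
                  sumℤ G (mapL f (concatMap g xs)) ≡
                  sumℤ G (mapL (λ x → sumℤ G (mapL f (g x))) xs)
  sum-concatMap f g []       = refl
  sum-concatMap f g (x ∷ xs) =
    trans (cong (sumℤ G) (mapL-++ f (g x) (concatMap g xs)))
          (trans (sum-++ (mapL f (g x)) _) (cong (sumℤ G (mapL f (g x)) +ℤ_) (sum-concatMap f g xs)))

  sum-allVecs-single : ∀ {n} (f : Vec (Fin N) n → ℤ) t → (∀ s → s ≢ t → f s ≡ 0ℤ) →
                       sumℤ G (mapL f (allVecs G n)) ≡ f t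
  sum-allVecs-single f []      f≡0 = ℤ.+-identityʳ (f [])
  sum-allVecs-single {suc n} f (x ∷ t) f≡0 = begin
    sumℤ G (mapL f (allVecs G (suc n)))                          ≡⟨ sum-concatMap f _ (allFin N) ⟩
    sumℤ G (mapL (λ y → sumℤ G (mapL f (mapL (y ∷_) V))) (allFin N))
      ≡⟨ cong (sumℤ G) (mapL-cong (λ y → cong (sumℤ G) (sym (mapL-∘ V))) (allFin N)) ⟩
    sumℤ G (mapL (λ y → sumℤ G (mapL (λ s → f (y ∷ s)) V)) (allFin N))
      ≡⟨ sum-allFin-single _ x (λ y y≢x → sum-zero _ V λ {s} _ → f≡0 (y ∷ s) (y≢x ∘ ∷-injectiveˡ)) ⟩
    sumℤ G (mapL (λ s → f (x ∷ s)) V)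
      ≡⟨ sum-allVecs-single _ t (λ s s≢t → f≡0 (x ∷ s) (s≢t ∘ ∷-injectiveʳ)) ⟩
    f (x ∷ t)                                                    ∎
    where
    open ≡-Reasoning
    V = allVecs G n

  sum-- : ∀ {A : Set} (f g : A → ℤ) xs →
          sumℤ G (mapL (λ x → f x - g x) xs) ≡ sumℤ G (mapL f xs) - sumℤ G (mapL g xs)
  sum-- f g []       = refl
  sum-- f g (x ∷ xs) =
    trans (cong (f x - g x +ℤ_) (sum-- f g xs)) (interchange (f x) (g x) _ _)
    where
    interchange : ∀ a b c d → (a - b) +ℤ (c - d) ≡ (a +ℤ c) - (b +ℤ d)
    interchange = solve-∀

  -- The boundary map

  δ-refl : ∀ {n} (t : Vec (Fin N) n) → δ G t t ≡ 1ℤ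
  δ-refl t with ≡-dec _≟ᶠ_ t t
  ... | yes _  = refl
  ... | no t≢t = contradiction refl t≢t

  δ-≢ : ∀ {n} {t s : Vec (Fin N) n} → t ≢ s → δ G t s ≡ 0ℤ
  δ-≢ {t = t} {s} t≢s with ≡-dec _≟ᶠ_ t s
  ... | yes t≡s = contradiction t≡s t≢s
  ... | no _    = refl

  faceCoeff-zero : ∀ {k} ℓ (t : Vec (Fin N) (suc k)) i s →
                   ¬ (lenM G (removeAt t i) ≡ just ℓ × removeAt t i ≡ s) →
                   faceCoeff G ℓ t i s ≡ 0ℤ
  faceCoeff-zero ℓ t i s h with lenM G (removeAt t i)
  ... | nothing = refl
  ... | just l with l ≟ ℓ
  ...   | yes refl = δ-≢ λ eq → h (refl , eq)
  ...   | no _     = refl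

  faceCoeff-one : ∀ {k} ℓ (t : Vec (Fin N) (suc k)) i → lenM G (removeAt t i) ≡ just ℓ →
                  faceCoeff G ℓ t i (removeAt t i) ≡ 1ℤ
  faceCoeff-one ℓ t i eq with lenM G (removeAt t i)
  faceCoeff-one ℓ t i refl | just l with l ≟ l
  ... | yes _  = δ-refl (removeAt t i)
  ... | no l≢l = contradiction refl l≢l

  faceCoeff-cong : ∀ {k} ℓ (t t′ : Vec (Fin N) (suc k)) i s → removeAt t i ≡ removeAt t′ i →
                   faceCoeff G ℓ t i s ≡ faceCoeff G ℓ t′ i s
  faceCoeff-cong ℓ t t′ i s eq
    with lenM G (removeAt t i) | lenM G (removeAt t′ i) | cong (lenM G) eq
  ... | nothing | _ | refl = refl
  ... | just l  | _ | refl rewrite eq = refl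

  sign≢0 : ∀ n → sign G n ≢ 0ℤ
  sign≢0 zero          ()
  sign≢0 (suc zero)    ()
  sign≢0 (suc (suc n)) = sign≢0 n

  -- The summand of `∂`, with the coefficient given as a number instead of a chain, so that it can
  -- be replaced by 1 for `δ G t` and split for a difference.
  boundaryTerm : ∀ {k} (ℓ : ℕ) → ℤ → (s : Vec (Fin N) k) → Vec (Fin N) (suc k) → Fin (suc k) → ℤ
  boundaryTerm ℓ a s t i =
    if isInterior i then a *ℤ (sign G (toℕ i) *ℤ faceCoeff G ℓ t i s) else 0ℤ

  boundaryTerm-interior : ∀ {k} ℓ a (s : Vec (Fin N) k) t {i} → Interior i →
    boundaryTerm ℓ a s t i ≡ a *ℤ (sign G (toℕ i) *ℤ faceCoeff G ℓ t i s)
  boundaryTerm-interior ℓ a s t p rewrite Interior⁻ p = refl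

  -- All reasons for a term to vanish are packed into one hypothesis: `removeAt t i ≢ s` has to be
  -- shown only after the other reasons are excluded.
  boundaryTerm-zero : ∀ {k} ℓ a (s : Vec (Fin N) k) t i →
    (a ≢ 0ℤ → Interior i → lenM G (removeAt t i) ≡ just ℓ → removeAt t i ≢ s) →
    boundaryTerm ℓ a s t i ≡ 0ℤ
  boundaryTerm-zero ℓ a s t i h with isInterior i in int
  ... | false = refl
  ... | true with a ℤ.≟ 0ℤ
  ...   | yes refl = refl
  ...   | no a≢0   = begin
    a *ℤ (sign G (toℕ i) *ℤ faceCoeff G ℓ t i s)
      ≡⟨ cong (λ e → a *ℤ (sign G (toℕ i) *ℤ e))
           (faceCoeff-zero ℓ t i s λ (len , eq) → h a≢0 (Interior⁺ int) len eq) ⟩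
    a *ℤ (sign G (toℕ i) *ℤ 0ℤ)  ≡⟨ cong (a *ℤ_) (ℤ.*-zeroʳ (sign G (toℕ i))) ⟩
    a *ℤ 0ℤ                      ≡⟨ ℤ.*-zeroʳ a ⟩
    0ℤ                           ∎
    where open ≡-Reasoning

  ∂-single : ∀ {k ℓ} (c : Chain G k) s t →
    (∀ t′ → t′ ≢ t → ∀ i → boundaryTerm ℓ (c t′) s t′ i ≡ 0ℤ) →
    ∂ G k ℓ c s ≡ sumℤ G (mapL (boundaryTerm ℓ (c t) s t) (allFin (suc k)))
  ∂-single c s t h =
    sum-allVecs-single _ t λ t′ t′≢t → sum-zero _ (allFin _) λ {i} _ → h t′ t′≢t i

  ∂-δ : ∀ {k ℓ} (t : Vec (Fin N) (suc k)) s →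
        ∂ G k ℓ (δ G t) s ≡ sumℤ G (mapL (boundaryTerm ℓ 1ℤ s t) (allFin (suc k)))
  ∂-δ {k} {ℓ} t s =
    trans (∂-single (δ G t) s t λ t′ t′≢t i →
             boundaryTerm-zero ℓ _ s t′ i λ δ≢0 → contradiction (δ-≢ (≢-sym t′≢t)) δ≢0)
          (cong (λ e → sumℤ G (mapL (boundaryTerm ℓ e s t) (allFin (suc k)))) (δ-refl t))

  ∂-δ-zero : ∀ {k ℓ} (t : Vec (Fin N) (suc k)) →
             (∀ {i} → Interior i → lenM G (removeAt t i) ≢ just ℓ) →
             ∀ s → ∂ G k ℓ (δ G t) s ≡ 0ℤ
  ∂-δ-zero {k} {ℓ} t h s =
    trans (∂-δ t s) (sum-zero _ (allFin (suc k)) λ {i} _ →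
      boundaryTerm-zero ℓ 1ℤ s t i λ _ p len → contradiction len (h p))

  ∂-- : ∀ {k ℓ} (c c′ : Chain G k) s →
        ∂ G k ℓ (λ t → c t - c′ t) s ≡ ∂ G k ℓ c s - ∂ G k ℓ c′ s
  ∂-- {k} {ℓ} c c′ s =
    trans (cong (sumℤ G) (mapL-cong inner (allVecs G (suc k)))) (sum-- _ _ (allVecs G (suc k)))
    where
    distrib : ∀ a b e → (a - b) *ℤ e ≡ a *ℤ e - b *ℤ e
    distrib = solve-∀

    term : ∀ t i → boundaryTerm ℓ (c t - c′ t) s t i ≡
                   boundaryTerm ℓ (c t) s t i - boundaryTerm ℓ (c′ t) s t i
    term t i with isInterior i
    ... | true  = distrib (c t) (c′ t) _
    ... | false = refl

    inner : ∀ t → sumℤ G (mapL (boundaryTerm ℓ (c t - c′ t) s t) (allFin (suc k))) ≡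
                  sumℤ G (mapL (boundaryTerm ℓ (c t) s t) (allFin (suc k))) -
                  sumℤ G (mapL (boundaryTerm ℓ (c′ t) s t) (allFin (suc k)))
    inner t = trans (cong (sumℤ G) (mapL-cong (term t) (allFin (suc k))))
                    (sum-- (boundaryTerm ℓ (c t) s t) (boundaryTerm ℓ (c′ t) s t) (allFin (suc k)))

  -- Consequences of the vanishing of eulerian magnitude homology

  -- A tuple with n+1 steps cannot have length n, so the bounding chain `b` is zero, and with it the
  -- cycle.
  eulerian-cycle-zero : ∀ {n} → EMHnnVanishes G n → (c : Chain G n) → InEMC G n n c →
                        (∀ s → ∂ G n n c s ≡ 0ℤ) → ∀ t → c t ≡ 0ℤ
  eulerian-cycle-zero {n} H c emc cyc t with H c emc cyc
  ... | b , emb , ∂b≡c = trans (sym (∂b≡c t))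
    (sum-zero _ (allVecs G _) λ {t′} _ → sum-zero _ (allFin _) λ {i} _ →
      boundaryTerm-zero n (b t′) t t′ i λ b≢0 →
        contradiction (steps≤length G t′ (proj₁ (emb t′ b≢0))) 1+n≰n)

  module _ (H : EMHnnVanishes G 2) where

    private
      eulerian-path : ∀ {a m b} → a ≢ b → Adj G a m → Adj G m b →
                      let t = a ∷ m ∷ b ∷ [] in lenM G t ≡ just 2 × Unique t
      eulerian-path a≢b a~m m~b =
        walk-length G (a~m ∷ m~b ∷ [-]) ,
        (Adj⇒≢ G a~m ∷ a≢b ∷ []) ∷ (Adj⇒≢ G m~b ∷ []) ∷ [] ∷ []

      δ-support : ∀ {n} {t s : Vec (Fin N) n} → δ G t s ≢ 0ℤ → t ≡ s
      δ-support δ≢0 = decidable-stable (≡-dec _≟ᶠ_ _ _) λ t≢s → δ≢0 (δ-≢ t≢s)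

    -- The only interior face of (a,m,b) is (a,b), whose length would be 1 instead of 2.
    no-triangle : ∀ {a m b} → Adj G a m → Adj G m b → ¬ Adj G a b
    no-triangle {a} {m} {b} a~m m~b a~b = contradiction 1≡0 λ ()
      where
      t = a ∷ m ∷ b ∷ []

      in-EMC : InEMC G 2 2 (δ G t)
      in-EMC s δ≢0 = subst (λ s → lenM G s ≡ just 2 × Unique s) (δ-support {t = t} δ≢0)
                           (eulerian-path (Adj⇒≢ G a~b) a~m m~b)

      short-face : ∀ {i} → Interior i → lenM G (removeAt t i) ≢ just 2
      short-face first eq with trans (sym eq) (walk-length G (a~b ∷ [-]))
      ... | ()
      short-face (later (later {i = ()} _))

      1≡0 : 1ℤ ≡ 0ℤ
      1≡0 = trans (sym (δ-refl t))
                  (eulerian-cycle-zero H (δ G t) in-EMC (∂-δ-zero t short-face) t)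

    -- Both paths have (a,b) as their only interior face, so their difference is a cycle. If m ≠ m′,
    -- its coefficient at (a,m,b) is 1.
    common-neighbour-unique : ∀ {a b m m′} → a ≢ b → Adj G a m → Adj G m b →
                              Adj G a m′ → Adj G m′ b → m ≡ m′
    common-neighbour-unique {a} {b} {m} {m′} a≢b a~m m~b a~m′ m′~b =
      decidable-stable (m ≟ᶠ m′) λ m≢m′ → contradiction (1≡0 m≢m′) λ ()
      where
      t  = a ∷ m ∷ b ∷ []
      t′ = a ∷ m′ ∷ b ∷ []

      c : Chain G 2
      c s = δ G t s - δ G t′ s

      in-EMC : InEMC G 2 2 c
      in-EMC s c≢0 with ≡-dec _≟ᶠ_ t s | ≡-dec _≟ᶠ_ t′ s
      ... | yes refl | _        = eulerian-path a≢b a~m m~b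
      ... | no _     | yes refl = eulerian-path a≢b a~m′ m′~b
      ... | no _     | no _     = contradiction refl c≢0

      cycle : ∀ s → ∂ G 2 2 c s ≡ 0ℤ
      cycle s = trans (∂-- (δ G t) (δ G t′) s) (ℤ.i≡j⇒i-j≡0 (begin
        ∂ G 2 2 (δ G t) s                                          ≡⟨ ∂-δ t s ⟩
        sumℤ G (mapL (boundaryTerm 2 1ℤ s t) (allFin 3))
          -- The end indices 0 and 2 contribute 0 by computation; index 1 has sign -1.
          ≡⟨ cong (λ e → 0ℤ +ℤ (1ℤ *ℤ (-1ℤ *ℤ e) +ℤ 0ℤ)) (faceCoeff-cong 2 t t′ (suc zero) s refl) ⟩
        sumℤ G (mapL (boundaryTerm 2 1ℤ s t′) (allFin 3))          ≡⟨ ∂-δ t′ s ⟨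
        ∂ G 2 2 (δ G t′) s                                         ∎))
        where open ≡-Reasoning

      1≡0 : m ≢ m′ → 1ℤ ≡ 0ℤ
      1≡0 m≢m′ = trans (sym (cong₂ _-_ (δ-refl t) (δ-≢ {t = t′} {t} λ { refl → m≢m′ refl })))
                       (eulerian-cycle-zero H c in-EMC cycle t)

    -- Supports of cycles

    -- Deleting a vertex of a walk creates one new step and keeps the others adjacent. As the face
    -- is not a walk, the new step is its only nonadjacent one, which fixes the index. The deleted
    -- vertex is then a common neighbour of the ends of that step, distinct by `Linked _≢_`, hence
    -- unique.
    face-determines-walk : ∀ {k} {t t′ : Vec (Fin N) (suc k)} {i i′} → Interior i → Interior i′ →
      Walk G t → Walk G t′ → removeAt t i ≡ removeAt t′ i′ →
      Linked _≢_ (removeAt t i) → ¬ Walk G (removeAt t i) → t ≡ t′ × i ≡ i′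
    face-determines-walk {t = a ∷ m ∷ b ∷ r} {a ∷ m′ ∷ b ∷ r} first first
      (a~m ∷ m~b ∷ _) (a~m′ ∷ m′~b ∷ _) refl (a≢b ∷ _) _ =
      cong (λ m → a ∷ m ∷ b ∷ r) (common-neighbour-unique a≢b a~m m~b a~m′ m′~b) , refl
    -- Different positions: `t′` makes the first step of the face adjacent and `t` makes the rest a
    -- walk. The next clause is the mirror image.
    face-determines-walk {t = a ∷ m ∷ b ∷ r} {a ∷ b ∷ z ∷ r′} first (later _)
      (_ ∷ _ ∷ w) (a~b ∷ _) refl _ ¬w = contradiction (a~b ∷ w) ¬w
    face-determines-walk {t = a ∷ b ∷ z ∷ r} {a ∷ m ∷ b ∷ r′} (later _) first
      (a~b ∷ _) (_ ∷ _ ∷ w) refl _ ¬w = contradiction (a~b ∷ w) ¬w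
    -- Both faces keep the adjacent first step, so the failure to be a walk lies in the tail.
    face-determines-walk {t = a ∷ y ∷ z ∷ r} {a′ ∷ y′ ∷ z′ ∷ r′} (later p) (later p′)
      (a~y ∷ w) (_ ∷ w′) eq (_ ∷ d) ¬w with ∷-injective eq
    ... | refl , eq′ with face-determines-walk p p′ w w′ eq′ d (¬w ∘ (a~y ∷_))
    ...   | refl , refl = refl , refl

    -- The coefficient of `∂ c` at the face collapses to `c t` up to sign: no other walk in the
    -- support has this face, and `t` has it at index `i` only.
    cycle-vanishes : ∀ {k} (c : Chain G k) → InMC G k k c → (∀ s → ∂ G k k c s ≡ 0ℤ) →
      ∀ t {i} → Interior i → lenM G (removeAt t i) ≡ just k → c t ≡ 0ℤ
    -- Assuming a nonzero coefficient places `t` in the support, so that `mc` shows it to be a walk.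
    cycle-vanishes {suc k} c mc cyc t {i} int len = decidable-stable (c t ℤ.≟ 0ℤ) λ c≢0 →
      let
        s = removeAt t i

        unique : ∀ t′ j → c t′ ≢ 0ℤ → Interior j → removeAt t′ j ≡ s → t ≡ t′ × i ≡ j
        unique t′ j c′≢0 int′ eq = face-determines-walk int int′
          (length⇒walk G t (mc t c≢0)) (length⇒walk G t′ (mc t′ c′≢0)) (sym eq)
          (trail-steps-distinct G s len)
          -- The face has one step fewer than `t` but the same length, so it is not a walk.
          (λ w → 1+n≢n (just-injective (trans (sym len) (walk-length G w))))

        open ≡-Reasoning

        product≡0 : c t *ℤ sign G (toℕ i) ≡ 0ℤ
        product≡0 = begin
          c t *ℤ sign G (toℕ i)
            ≡⟨ cong (c t *ℤ_) (ℤ.*-identityʳ _) ⟨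
          c t *ℤ (sign G (toℕ i) *ℤ 1ℤ)
            ≡⟨ cong (λ e → c t *ℤ (sign G (toℕ i) *ℤ e)) (faceCoeff-one _ t i len) ⟨
          c t *ℤ (sign G (toℕ i) *ℤ faceCoeff G _ t i s)
            ≡⟨ boundaryTerm-interior _ (c t) s t int ⟨
          boundaryTerm _ (c t) s t i
            ≡⟨ sum-allFin-single _ i (λ j j≢i → boundaryTerm-zero _ (c t) s t j λ c≢0 int′ _ eq →
                 j≢i (sym (proj₂ (unique t j c≢0 int′ eq)))) ⟨
          sumℤ G (mapL (boundaryTerm _ (c t) s t) (allFin _))
            ≡⟨ ∂-single c s t (λ t′ t′≢t j → boundaryTerm-zero _ (c t′) s t′ j λ c≢0 int′ _ eq →
                 t′≢t (sym (proj₁ (unique t′ j c≢0 int′ eq)))) ⟨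
          ∂ G _ _ c s  ≡⟨ cyc s ⟩
          0ℤ           ∎
      in [ c≢0 , sign≢0 (toℕ i) ]′ (ℤ.i*j≡0⇒i≡0∨j≡0 (c t) product≡0)

    -- If consecutive entries a, m, b have a ≠ b, then a and b are not adjacent, as there is no
    -- triangle. They are at distance 2, and deleting m keeps the length.
    faceless-walk-alternates : ∀ {k x y} {r : Vec (Fin N) k} → Walk G (x ∷ y ∷ r) →
      (∀ {i} → Interior i → lenM G (removeAt (x ∷ y ∷ r) i) ≢ just (suc k)) →
      x ∷ y ∷ r ≡ alt G x y (suc (suc k))
    faceless-walk-alternates {r = []} w h = refl
    faceless-walk-alternates {x = a} {m} {b ∷ r} (a~m ∷ m~b ∷ w) h with a ≟ᶠ b
    ... | yes refl = cong (a ∷_) (faceless-walk-alternates (m~b ∷ w)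
      -- An interior index of the tail is positive, so the face still starts with `m` and can be
      -- extended by the adjacent `a`.
      λ { {suc i} p len → h (later p) (lenM-Adj-∷ G (removeAt (b ∷ r) i) a~m len) })
    ... | no a≢b = contradiction
      (lenM-∷⁺ G a b r a≢b
        (common-neighbour⇒dist≡2 G a≢b (no-triangle a~m m~b) a~m m~b) (walk-length G w))
      (h first)

    cycle⇒alternating-span : ∀ {k} (c : Chain G (suc k)) → InMC G (suc k) (suc k) c →
      (∀ s → ∂ G (suc k) (suc k) c s ≡ 0ℤ) → InAltSpan G (suc k) c
    cycle⇒alternating-span {k} c mc cyc =
      -- Alternating trails are determined by their first two entries, so coefficients are read off
      -- from `c`. For u = v the tuple is no trail and `c` is 0 there.
      (λ u v → c (alt G u v (2 + k))) , supported , expansion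
      where
      supported : ∀ u v → c (alt G u v (2 + k)) ≢ 0ℤ →
                  u ≢ v × lenM G (alt G u v (2 + k)) ≡ just (suc k)
      supported u v c≢0 with mc (alt G u v (2 + k)) c≢0
      ... | len with trail-steps-distinct G (alt G u v (2 + k)) len
      ...   | u≢v ∷ _ = u≢v , len

      coefficient : ∀ u v r → let t = u ∷ v ∷ r in
                    c t ≡ c (alt G u v (2 + k)) *ℤ δ G (alt G u v (2 + k)) t
      coefficient u v r with ≡-dec _≟ᶠ_ (alt G u v (2 + k)) (u ∷ v ∷ r)
      ... | yes eq = trans (cong c (sym eq)) (sym (ℤ.*-identityʳ _))
      -- A walk in the support that does not alternate would have a face of full length, contrary to
      -- `cycle-vanishes`.
      ... | no neq = trans (decidable-stable (c t ℤ.≟ 0ℤ) λ c≢0 →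
              neq (sym (faceless-walk-alternates (length⇒walk G t (mc t c≢0))
                λ p len → c≢0 (cycle-vanishes c mc cyc t p len))))
              (sym (ℤ.*-zeroʳ (c (alt G u v (2 + k)))))
        where t = u ∷ v ∷ r

      term-zero : ∀ u v t → alt G u v (2 + k) ≢ t →
                  c (alt G u v (2 + k)) *ℤ δ G (alt G u v (2 + k)) t ≡ 0ℤ
      term-zero u v t neq = trans (cong (c (alt G u v (2 + k)) *ℤ_) (δ-≢ neq)) (ℤ.*-zeroʳ (c (alt G u v (2 + k))))

      expansion : ∀ t → c t ≡ sumℤ G (mapL (λ u → sumℤ G (mapL (λ v →
                    c (alt G u v (2 + k)) *ℤ δ G (alt G u v (2 + k)) t) (allFin N))) (allFin N))
      expansion t@(u ∷ v ∷ r) = trans (coefficient u v r) (sym (trans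
        (sum-allFin-single _ u λ u′ u′≢u → sum-zero _ (allFin N) λ {v′} _ →
          term-zero u′ v′ t (u′≢u ∘ ∷-injectiveˡ))
        (sum-allFin-single _ v λ v′ v′≢v →
          term-zero u v′ t (v′≢v ∘ ∷-injectiveˡ ∘ ∷-injectiveʳ))))

  -- Deleting an interior entry makes its two equal neighbours consecutive, so the face is not a
  -- trail.
  alternating-faceless : ∀ {k ℓ i} u v → Interior i → lenM G (removeAt (alt G u v (suc k)) i) ≢ just ℓ
  alternating-faceless {suc (suc k)} u v first eq =
    proj₁ (lenM-∷⁻ G u u (alt G v u k) eq) refl
  alternating-faceless {suc (suc k)} {i = suc (suc i)} u v (later p) eq
    with lenM-∷⁻ G u v (removeAt (alt G u v (suc k)) i) eq
  ... | _ , _ , _ , _ , len , _ = alternating-faceless v u p len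

theorem3p2 : (k : ℕ) → 2 ≤ k → {N : ℕ} (G : Graph N) →
  (∀ n → 2 ≤ n → n ≤ k → EMHnnVanishes G n) →
  -- MC_{k+1,k}(G) = 0, so MH_{k,k}(G) = ker ∂_{k,k}
  (∀ (t : Vec' G (suc k)) → lenM G t ≢ just k) ×
  -- every alternating k-trail of length k is a cycle
  (∀ (u v : Fin N) → u ≢ v → lenM G (alt G u v (suc k)) ≡ just k →
     ∀ s → ∂ G k k (δ G (alt G u v (suc k))) s ≡ 0ℤ) ×
  -- every cycle in MC_{k,k}(G) is a ℤ-combination of alternating k-trails
  (∀ (c : Chain G k) → InMC G k k c → (∀ s → ∂ G k k c s ≡ 0ℤ) → InAltSpan G k c)
theorem3p2 k@(suc _) 2≤k G H =
  (λ t len → 1+n≰n (steps≤length G t len)) ,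
  (λ u v _ _ → ∂-δ-zero G (alt G u v (suc k)) (alternating-faceless G u v)) ,
  cycle⇒alternating-span G (H 2 ≤-refl 2≤k)
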